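{- Let $\mathcal F\subseteq\omega^\omega$ and let $\mathcal I,\mathcal J$ be ideals on $\omega$ such that $\mathcal I$ is tall and $\mathcal I\not\le_{\mathcal F}\mathcal J\restriction A$ for all $A\notin\mathcal J$. Then: (1) $\mathfrak p(\mathcal J)\le\mathfrak{fip}(\mathcal I,\mathcal J,\mathcal F)$; (2) $\operatorname{add}^*(\mathcal I)\le\mathfrak{fip}(\mathcal I,\mathcal J,\mathcal F)$.
   Context: An ideal on a set $X$ is a family of subsets of $X$ closed under finite unions and subsets, containing all finite subsets of $X$ and not containing $X$; $\mathcal J^+$ is the family of subsets of $X$ not in $\mathcal J$. $\mathcal I$ on $\omega$ is tall if every infinite $A\subseteq\omega$ contains an infinite $B\in\mathcal I$. For $A\notin\mathcal J$, $\mathcal J\restriction A=\{B\cap A:B\in\mathcal J\}$ (an ideal on $A$), and $\mathcal I\le_{\mathcal F}\mathcal J\restriction A$ means that there is $f\in\mathcal F$ with $f^{ -1}[B]\cap A\in\mathcal J$ for every $B\in\mathcal I$ (functions in $\mathcal F$ are restricted to $A$). A nonempty family $\mathcal A\subseteq\mathcal P(\omega)$ has $\mathcal J^+$-FIP if $\bigcap F\in\mathcal J^+$ for each finite $F\subseteq\mathcal A$. A set $B\in\mathcal J^+$ is a $\mathcal J^+$-pseudointersection of $\mathcal A$ if $B\setminus A\in\mathcal J$ for each $A\in\mathcal A$. With $\mathfrak c=2^{\aleph_0}$: $\mathfrak p(\mathcal J)=\min(\{|\mathcal A|:\mathcal A$ has $\mathcal J^+$-FIP but has no $\mathcal J^+$-pseudointersection$\}\cup\{\mathfrak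 c^+\})$; $\operatorname{add}^*(\mathcal I)=\min\{|\mathcal A|:\mathcal A\subseteq\mathcal I$ and there is no $B\in\mathcal I$ with $A\setminus B$ finite for all $A\in\mathcal A\}$ (well defined for tall $\mathcal I$); $\mathfrak{fip}(\mathcal I,\mathcal J,\mathcal F)$ is the minimum of the set consisting of $\mathfrak c^+$ and all cardinals $|\mathcal A|$ such that $\mathcal A\subseteq\mathcal P(\omega)$ has $\mathcal J^+$-FIP and it is not true that for every $f\in\mathcal F$ there is $B\in\mathcal I$ such that $\mathcal A\cup\{f^{ -1}[B]\}$ has $\mathcal J^+$-FIP. -}

module Defs where

open import Data.List.Base using (List; foldr)
open import Data.List.Membership.Propositional using () renaming (_∈_ to _∈ˡ_)
open import Data.List.Relation.Unary.All using (All)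
open import Data.Nat.Base using (ℕ)
open import Data.Product.Base using (∃; ∃-syntax; _×_; proj₁)
open import Function.Bundles using (Bijection; Injection)
open import Level using (Level; 0ℓ; suc)
open import Relation.Binary.Bundles using (Setoid)
import Relation.Binary.Construct.On as On
open import Relation.Nullary.Negation.Core using (¬_)
open import Relation.Unary
open import Relation.Unary.Relation.Binary.Equality using (≐-setoid)

------------------------------------------------------------------------
-- Subsets and families of subsets

-- Subsets are compared by _≐_ (same elements) throughout. A family is
-- any predicate on subsets; it stands for the set of ≐-classes of its
-- members, and is not itself required to respect _≐_.

Subset : Set → Set₁
Subset X = Pred X 0ℓ

Family : Set → Set₂
Family X = Pred (Subset X) (suc 0ℓ)

Finite : {X : Set} → Subset X → Set
Finite A = ∃[ xs ] (∀ {x} → x ∈ A → x ∈ˡ xs)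

Infinite : {X : Set} → Subset X → Set
Infinite A = ¬ Finite A

⋂ᶠ : {X : Set} → List (Subset X) → Subset X
⋂ᶠ = foldr _∩_ U

------------------------------------------------------------------------
-- Ideals

record IsIdeal {X : Set} (𝒥 : Family X) : Set₁ where
  field
    ∪-closed : ∀ {A B} → A ∈ 𝒥 → B ∈ 𝒥 → (A ∪ B) ∈ 𝒥
    ⊆-closed : ∀ {A B} → A ⊆ B → B ∈ 𝒥 → A ∈ 𝒥
    finite   : ∀ {A} → Finite A → A ∈ 𝒥
    proper   : U ∉ 𝒥

_⁺ : {X : Set} → Family X → Family X
(𝒥 ⁺) A = A ∉ 𝒥

Tall : Family ℕ → Set₁
Tall ℐ = ∀ A → Infinite A → ∃[ B ] (Infinite B × B ⊆ A × B ∈ ℐ)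

Functions : Set₂
Functions = Pred (ℕ → ℕ) (suc 0ℓ)

-- f ⊢ B is the preimage f⁻¹[B].

_≤[_]_↾_ : Family ℕ → Functions → Family ℕ → Subset ℕ → Set₁
ℐ ≤[ ℱ ] 𝒥 ↾ A = ∃[ f ] (f ∈ ℱ × (∀ B → B ∈ ℐ → ((f ⊢ B) ∩ A) ∈ 𝒥))

------------------------------------------------------------------------
-- Finite intersection property and pseudointersections

-- Finite subfamilies are listed. The empty list contributes only
-- U ∈ 𝒥 ⁺, which holds for every ideal.

FIP⁺ : Family ℕ → Family ℕ → Set₁
FIP⁺ 𝒥 𝒜 = Satisfiable 𝒜 × (∀ F → All (_∈ 𝒜) F → ⋂ᶠ F ∈ 𝒥 ⁺)

IsPseudointersection⁺ : Family ℕ → Family ℕ → Subset ℕ → Set₁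
IsPseudointersection⁺ 𝒥 𝒜 B = B ∈ 𝒥 ⁺ × (∀ A → A ∈ 𝒜 → (B ∖ A) ∈ 𝒥)

-- 𝒜 ∪ {B}
_▹_ : Family ℕ → Subset ℕ → Family ℕ
𝒜 ▹ B = 𝒜 ∪ (_≐ B)

------------------------------------------------------------------------
-- Cardinals

-- A set is a setoid and cardinals are setoids up to bijection, so that
-- families can be counted up to _≐_. Excluded middle (for all types)
-- together with function extensionality gives every setoid a
-- transversal, so under these axioms a setoid is as good as its quotient
-- and _≤ᶜ_ is the usual comparison of cardinals in ZFC.

Cardinal : Set₂
Cardinal = Setoid (suc 0ℓ) 0ℓ

infix 4 _≤ᶜ_ _<ᶜ_ _≈ᶜ_

_≈ᶜ_ _≤ᶜ_ _<ᶜ_ : Cardinal → Cardinal → Set₁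
κ ≈ᶜ μ = Bijection κ μ
κ ≤ᶜ μ = Injection κ μ
κ <ᶜ μ = κ ≤ᶜ μ × ¬ (μ ≤ᶜ κ)

card : Family ℕ → Cardinal
card 𝒜 = On.setoid (≐-setoid ℕ 0ℓ) (proj₁ {B = 𝒜})

-- 2^ℵ₀ as the cardinality of the power set of ℕ.
𝔠 : Cardinal
𝔠 = ≐-setoid ℕ 0ℓ

IsSuccessor : Cardinal → Pred Cardinal (suc (suc 0ℓ))
IsSuccessor κ κ⁺ = κ <ᶜ κ⁺ × (∀ μ → κ <ᶜ μ → κ⁺ ≤ᶜ μ)

-- The class of all |𝒜| with 𝒜 satisfying P.
Cards : Pred (Family ℕ) (suc 0ℓ) → Pred Cardinal (suc (suc 0ℓ))
Cards P κ = ∃[ 𝒜 ] (P 𝒜 × κ ≈ᶜ card 𝒜)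

record IsMinimum (S : Pred Cardinal (suc (suc 0ℓ))) (κ : Cardinal) :
                 Set (suc (suc 0ℓ)) where
  field
    member : κ ∈ S
    least  : ∀ μ → μ ∈ S → κ ≤ᶜ μ

------------------------------------------------------------------------
-- Cardinal invariants, each given as the property of being the minimum
-- that defines it. The class IsSuccessor 𝔠 plays the role of {𝔠⁺}.

Is-𝔭 : Family ℕ → Pred Cardinal (suc (suc 0ℓ))
Is-𝔭 𝒥 = IsMinimum (Cards Bad ∪ IsSuccessor 𝔠)
  where
  Bad : Pred (Family ℕ) (suc 0ℓ)
  Bad 𝒜 = FIP⁺ 𝒥 𝒜 × ¬ ∃ (IsPseudointersection⁺ 𝒥 𝒜)

Is-add* : Family ℕ → Pred Cardinal (suc (suc 0ℓ))
Is-add* ℐ = IsMinimum (Cards Bad)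
  where
  Bad : Pred (Family ℕ) (suc 0ℓ)
  Bad 𝒜 = 𝒜 ⊆ ℐ × ¬ (∃[ B ] (B ∈ ℐ × (∀ A → A ∈ 𝒜 → Finite (A ∖ B))))

Is-𝔣𝔦𝔭 : Family ℕ → Family ℕ → Functions → Pred Cardinal (suc (suc 0ℓ))
Is-𝔣𝔦𝔭 ℐ 𝒥 ℱ = IsMinimum (Cards Bad ∪ IsSuccessor 𝔠)
  where
  Bad : Pred (Family ℕ) (suc 0ℓ)
  Bad 𝒜 = FIP⁺ 𝒥 𝒜 ×
          ¬ (∀ f → f ∈ ℱ → ∃[ B ] (B ∈ ℐ × FIP⁺ 𝒥 (𝒜 ▹ (f ⊢ B))))

{-# OPTIONS --safe #-}
module Submission where

-- Both parts concern a family 𝒜 with the 𝒥⁺-FIP and a function f ∈ ℱ for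
-- which no B ∈ ℐ makes 𝒜 ∪ {f⁻¹[B]} have the 𝒥⁺-FIP. (If 𝔣𝔦𝔭 is instead
-- 𝔠⁺, both inequalities are immediate.)
--
-- (1) Such an 𝒜 has no 𝒥⁺-pseudointersection: if C were one, then ℐ being
-- not below 𝒥 ↾ C gives B ∈ ℐ with f⁻¹[B] ∩ C ∉ 𝒥, and every finite
-- intersection of members of 𝒜 contains C up to a set in 𝒥
-- (pseudointersection⇒extends). Hence 𝒜 witnesses 𝔭(𝒥) ≤ |𝒜|.
--
-- (2) Suppose that add* ≰ |𝒜|. Then 𝒜 is infinite, as a finite 𝒜 has its
-- intersection as a pseudointersection. Say that B hits A robustly if
-- f⁻¹[B ∖ K] ∩ A ∉ 𝒥 for every finite K; this persists when B is replaced
-- by a set that almost includes it. The removal of K matters because f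
-- need not be finite-to-one. If some finite K has f⁻¹[K] ∩ A ∉ 𝒥 for all A in
-- the filter generated by 𝒜, then B = K contradicts the choice of 𝒜 and f.
-- Otherwise every A in that filter is hit robustly by some B ∈ ℐ
-- (robust-exists). Let N be the set of n with f⁻¹{n} ∩ A ∉ 𝒥. If N is
-- infinite, tallness gives an infinite B ⊆ N in ℐ, and it works. If N is
-- finite, shrink A within the filter so that f⁻¹[N] ∩ A ∈ 𝒥; then f⁻¹[K] ∩ A
-- is in 𝒥 for all finite K, so any B ∈ ℐ with f⁻¹[B] ∩ A ∉ 𝒥 is as desired.
--
-- It remains to find one B for all A. Fewer than add* requirements on
-- B ∈ ℐ that are each preserved by almost inclusion can be met
-- simultaneously once each can be met (uniformise). No cardinal
-- arithmetic for finite subsets of 𝒜 is needed: applying this to 𝒜 itself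
-- n times handles all intersections of n members (uniform-length), and
-- applying it once more to ℕ, which embeds in the infinite 𝒜, handles all n.
--
-- Since excluded middle is a decision function on types, it provides the
-- choices in these arguments; with function extensionality they can be
-- made to respect the equality of a setoid (rep).

open import Defs
open import Axiom.ExcludedMiddle using (ExcludedMiddle)
open import Axiom.Extensionality.Propositional using (Extensionality)
open import Data.Bool.Base using (Bool; T)
open import Data.Empty using (⊥-elim)
open import Data.List.Base using (List; []; _∷_; _++_; length; map)
open import Data.List.Membership.Propositional using () renaming (_∈_ to _∈ˡ_)
open import Data.List.Membership.Propositional.Properties using (∈-++⁺ˡ; ∈-++⁺ʳ)
import Data.List.Membership.Setoid as SetoidMembership
open import Data.List.Relation.Unary.All using (All; []; _∷_)
open import Data.List.Relation.Unary.All.Properties using (++⁺)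
open import Data.List.Relation.Unary.Any as Any using (here; there)
open import Data.Nat.Base using (ℕ; zero; suc; _<_)
open import Data.Nat.Properties using (<-cmp; m<1+n⇒m<n∨m≡n)
open import Data.Product.Base using (_×_; _,_; ∃; ∃-syntax; proj₁; proj₂)
open import Data.Sum.Base using (inj₁; inj₂)
open import Data.Unit.Base using (tt)
open import Function.Base using (_∘_; id)
open import Function.Bundles using (Bijection; Surjection)
import Function.Construct.Identity as Identity
import Function.Properties.Injection as Injectionₚ
open import Level using (Lift; lift; lower; 0ℓ) renaming (suc to lsuc)
open import Relation.Binary.Bundles using (Setoid)
import Relation.Binary.Construct.On as On
open import Relation.Binary.Definitions using (tri<; tri≈; tri>)
open import Relation.Binary.PropositionalEquality
  using (_≡_; refl; cong; setoid)
open import Relation.Nullary.Decidable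
  using (yes; no; isYes; True; toWitness; fromWitness; decidable-stable)
open import Relation.Nullary.Negation using (¬_; contradiction)
open import Relation.Unary
open import Relation.Unary.Relation.Binary.Equality using (≐-setoid)

-- Positive sets and generated filters

⁺-mono : ∀ {X} {𝒥 : Family X} → IsIdeal 𝒥 →
         ∀ {A B} → A ⊆ B → A ∉ 𝒥 → B ∉ 𝒥
⁺-mono 𝒥-ideal A⊆B A∉𝒥 B∈𝒥 = A∉𝒥 (IsIdeal.⊆-closed 𝒥-ideal A⊆B B∈𝒥)

-- The filter generated by 𝒜: all supersets of finite intersections of
-- members of 𝒜.
Filter : Family ℕ → Family ℕ
Filter 𝒜 A = ∃[ F ] (All (_∈ 𝒜) F × ⋂ᶠ F ⊆ A)

⋂ᶠ-++ : ∀ {X} (F G : List (Subset X)) → ⋂ᶠ (F ++ G) ⊆ ⋂ᶠ F ∩ ⋂ᶠ G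
⋂ᶠ-++ []      G p       = tt , p
⋂ᶠ-++ (A ∷ F) G (p , q) = let r , s = ⋂ᶠ-++ F G q in (p , r) , s

U∈Filter : ∀ {𝒜} → U ∈ Filter 𝒜
U∈Filter = [] , [] , λ _ → tt

⊆Filter : ∀ {𝒜 A} → A ∈ 𝒜 → A ∈ Filter 𝒜
⊆Filter {A = A} A∈𝒜 = A ∷ [] , A∈𝒜 ∷ [] , proj₁

Filter-∩ : ∀ {𝒜 A B} → A ∈ Filter 𝒜 → B ∈ Filter 𝒜 → (A ∩ B) ∈ Filter 𝒜
Filter-∩ (F , F⊆𝒜 , F⊆A) (G , G⊆𝒜 , G⊆B) =
  F ++ G , ++⁺ F⊆𝒜 G⊆𝒜 ,
  λ p → let q , r = ⋂ᶠ-++ F G p in F⊆A q , G⊆B r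

module _ {𝒥 𝒜 : Family ℕ} (𝒥-ideal : IsIdeal 𝒥) where

  Filter-⁺ : FIP⁺ 𝒥 𝒜 → ∀ {A} → A ∈ Filter 𝒜 → A ∉ 𝒥
  Filter-⁺ fip (F , F⊆𝒜 , F⊆A) = ⁺-mono 𝒥-ideal F⊆A (proj₂ fip F F⊆𝒜)

  -- E may be added to 𝒜 if it meets every finite intersection of members
  -- of 𝒜 in a positive set.
  extend-FIP : Satisfiable 𝒜 → ∀ {E} →
               (∀ F → All (_∈ 𝒜) F → (E ∩ ⋂ᶠ F) ∉ 𝒥) → FIP⁺ 𝒥 (𝒜 ▹ E)
  extend-FIP (A₀ , A₀∈𝒜) {E} pos = (A₀ , inj₁ A₀∈𝒜) , λ G G⊆ →
    let F , F⊆𝒜 , F⊆G = members G G⊆ in ⁺-mono 𝒥-ideal F⊆G (pos F F⊆𝒜)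
    where
    members : ∀ G → All (_∈ (𝒜 ▹ E)) G →
              ∃[ F ] (All (_∈ 𝒜) F × (E ∩ ⋂ᶠ F) ⊆ ⋂ᶠ G)
    members []      []              = [] , [] , λ _ → tt
    members (A ∷ G) (inj₁ A∈𝒜 ∷ G⊆) =
      let F , F⊆𝒜 , F⊆G = members G G⊆
      in A ∷ F , A∈𝒜 ∷ F⊆𝒜 , λ (e , a , r) → a , F⊆G (e , r)
    members (A ∷ G) (inj₂ A≐E ∷ G⊆) =
      let F , F⊆𝒜 , F⊆G = members G G⊆
      in F , F⊆𝒜 , λ (e , r) → proj₂ A≐E e , F⊆G (e , r)

-- Robust intersections

-- B hits A robustly along f: f⁻¹[B] ∩ A stays 𝒥-positive when any finite
-- set is removed from B.
Robust : Family ℕ → (ℕ → ℕ) → Subset ℕ → Subset ℕ → Set₁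
Robust 𝒥 f A B = ∀ K → ((f ⊢ (B ∖ (_∈ˡ K))) ∩ A) ∉ 𝒥

-- For all A₁, …, Aₙ ∈ 𝒜, B hits A ∩ A₁ ∩ … ∩ Aₙ robustly.
RobustBelow : Family ℕ → (ℕ → ℕ) → Family ℕ → ℕ → Subset ℕ → Subset ℕ → Set₁
RobustBelow 𝒥 f 𝒜 zero    A B = Robust 𝒥 f A B
RobustBelow 𝒥 f 𝒜 (suc n) A B =
  ∀ A′ → A′ ∈ 𝒜 → RobustBelow 𝒥 f 𝒜 n (A ∩ A′) B

module _ {𝒥 : Family ℕ} (𝒥-ideal : IsIdeal 𝒥) {f : ℕ → ℕ} where
  open IsIdeal 𝒥-ideal

  Robust-mono : ∀ {A A′ B} → A ⊆ A′ → Robust 𝒥 f A B → Robust 𝒥 f A′ B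
  Robust-mono A⊆A′ r K = ⁺-mono 𝒥-ideal (λ (p , a) → p , A⊆A′ a) (r K)

  RobustBelow-mono : ∀ {𝒜} n {A A′ B} → A ⊆ A′ →
                     RobustBelow 𝒥 f 𝒜 n A B → RobustBelow 𝒥 f 𝒜 n A′ B
  RobustBelow-mono zero    {B = B} A⊆A′ r       = Robust-mono {B = B} A⊆A′ r
  RobustBelow-mono (suc n) {B = B} A⊆A′ r C C∈𝒜 =
    RobustBelow-mono n {B = B} (λ (a , c) → A⊆A′ a , c) (r C C∈𝒜)

  RobustBelow⇒⋂ : ∀ {𝒜 A B} F → All (_∈ 𝒜) F →
                  RobustBelow 𝒥 f 𝒜 (length F) A B → Robust 𝒥 f (A ∩ ⋂ᶠ F) B
  RobustBelow⇒⋂ {B = B} [] [] r = Robust-mono {B = B} (λ a → a , tt) r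
  RobustBelow⇒⋂ {B = B} (C ∷ F) (C∈𝒜 ∷ F⊆𝒜) r =
    Robust-mono {B = B} (λ ((a , c) , p) → a , c , p)
      (RobustBelow⇒⋂ {B = B} F F⊆𝒜 (r C C∈𝒜))

  null-fibres : ∀ {A} → (∀ n → ((f ⊢ (_≡ n)) ∩ A) ∈ 𝒥) →
                ∀ K → ((f ⊢ (_∈ˡ K)) ∩ A) ∈ 𝒥
  null-fibres null []      = ⊆-closed (λ { (() , _) }) (finite ([] , id))
  null-fibres null (n ∷ K) =
    ⊆-closed (λ { (here p , a) → inj₁ (p , a) ; (there p , a) → inj₂ (p , a) })
             (∪-closed (null n) (null-fibres null K))

-- Classical arguments

module Classical (em : ∀ {ℓ} → ExcludedMiddle ℓ) where

  by-contradiction : ∀ {ℓ} {P : Set ℓ} → ¬ ¬ P → P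
  by-contradiction = decidable-stable em

  Robust-almost-mono : ∀ {𝒥 : Family ℕ} {f} → IsIdeal 𝒥 →
                       ∀ {A B C} → Finite (B ∖ C) →
                       Robust 𝒥 f A B → Robust 𝒥 f A C
  Robust-almost-mono 𝒥-ideal (L , B∖C⊆L) r K =
    ⁺-mono 𝒥-ideal
      (λ ((b , ∉K++L) , a) →
         ( by-contradiction (λ ∉C → ∉K++L (∈-++⁺ʳ K (B∖C⊆L (b , ∉C))))
         , ∉K++L ∘ ∈-++⁺ˡ ) , a)
      (r (K ++ L))

  RobustBelow-almost-mono :
    ∀ {𝒥 : Family ℕ} {f 𝒜} → IsIdeal 𝒥 → ∀ n {A B C} → Finite (B ∖ C) →
    RobustBelow 𝒥 f 𝒜 n A B → RobustBelow 𝒥 f 𝒜 n A C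
  RobustBelow-almost-mono {𝒥} {f} 𝒥-ideal zero B⊆*C r =
    Robust-almost-mono {𝒥} {f} 𝒥-ideal B⊆*C r
  RobustBelow-almost-mono 𝒥-ideal (suc n) B⊆*C r A A∈𝒜 =
    RobustBelow-almost-mono 𝒥-ideal n B⊆*C (r A A∈𝒜)

  positive-preimage : ∀ {ℱ} {ℐ 𝒥 : Family ℕ} →
                      (∀ A → A ∉ 𝒥 → ¬ (ℐ ≤[ ℱ ] 𝒥 ↾ A)) →
                      ∀ {f} → f ∈ ℱ → ∀ A → A ∉ 𝒥 →
                      ∃[ B ] (B ∈ ℐ × ((f ⊢ B) ∩ A) ∉ 𝒥)
  positive-preimage ≰ {f} f∈ℱ A A∉𝒥 = by-contradiction λ none →
    ≰ A A∉𝒥 (f , f∈ℱ , λ B B∈ℐ → by-contradiction λ ∉𝒥 → none (B , B∈ℐ , ∉𝒥))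

  almost-below-⋂ : ∀ {𝒥 𝒜 : Family ℕ} {C} → IsIdeal 𝒥 →
                   (∀ A → A ∈ 𝒜 → (C ∖ A) ∈ 𝒥) →
                   ∀ F → All (_∈ 𝒜) F → (C ∖ ⋂ᶠ F) ∈ 𝒥
  almost-below-⋂ 𝒥-ideal C⊆ [] [] =
    IsIdeal.finite 𝒥-ideal ([] , λ (_ , ∉U) → ⊥-elim (∉U tt))
  almost-below-⋂ {C = C} 𝒥-ideal C⊆ (A ∷ F) (A∈𝒜 ∷ F⊆𝒜) =
    ⊆-closed cover (∪-closed (C⊆ A A∈𝒜) (almost-below-⋂ 𝒥-ideal C⊆ F F⊆𝒜))
    where
    open IsIdeal 𝒥-ideal
    cover : (C ∖ (A ∩ ⋂ᶠ F)) ⊆ ((C ∖ A) ∪ (C ∖ ⋂ᶠ F))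
    cover {x} (c , ∉) with em {P = x ∈ A}
    ... | yes a = inj₂ (c , λ p → ∉ (a , p))
    ... | no ∉A = inj₁ (c , ∉A)

  pseudointersection⇒extends :
    ∀ {ℱ} {ℐ 𝒥 𝒜 : Family ℕ} → IsIdeal 𝒥 → (∀ A → A ∉ 𝒥 → ¬ (ℐ ≤[ ℱ ] 𝒥 ↾ A)) →
    Satisfiable 𝒜 → ∃ (IsPseudointersection⁺ 𝒥 𝒜) →
    ∀ f → f ∈ ℱ → ∃[ B ] (B ∈ ℐ × FIP⁺ 𝒥 (𝒜 ▹ (f ⊢ B)))
  pseudointersection⇒extends 𝒥-ideal ≰ 𝒜-nonempty (C , C∉𝒥 , C⊆) f f∈ℱ
    with positive-preimage ≰ f∈ℱ C C∉𝒥
  ... | B , B∈ℐ , pos = B , B∈ℐ , extend-FIP 𝒥-ideal 𝒜-nonempty λ F F⊆𝒜 small →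
    pos (⊆-closed (cover F) (∪-closed small (almost-below-⋂ 𝒥-ideal C⊆ F F⊆𝒜)))
    where
    open IsIdeal 𝒥-ideal
    cover : ∀ F → ((f ⊢ B) ∩ C) ⊆ (((f ⊢ B) ∩ ⋂ᶠ F) ∪ (C ∖ ⋂ᶠ F))
    cover F {x} (b , c) with em {P = x ∈ ⋂ᶠ F}
    ... | yes p = inj₁ (b , p)
    ... | no ∉F = inj₂ (c , ∉F)

  -- The set of n with f⁻¹{n} ∩ A positive. Being positive is a large
  -- proposition; True replaces it by an equivalent small one.
  PositiveFibres : Family ℕ → (ℕ → ℕ) → Subset ℕ → Subset ℕ
  PositiveFibres 𝒥 f A n = True (em {P = ((f ⊢ (_≡ n)) ∩ A) ∉ 𝒥})

  -- If no finite set K has all f⁻¹[K] ∩ A positive, every A in the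
  -- filter is hit robustly.
  robust-exists :
    ∀ {ℱ} {ℐ 𝒥 𝒜 : Family ℕ} → IsIdeal 𝒥 → Tall ℐ →
    (∀ A → A ∉ 𝒥 → ¬ (ℐ ≤[ ℱ ] 𝒥 ↾ A)) → FIP⁺ 𝒥 𝒜 →
    ∀ {f} → f ∈ ℱ →
    (∀ K → ∃[ A ] (A ∈ Filter 𝒜 × ((f ⊢ (_∈ˡ K)) ∩ A) ∈ 𝒥)) →
    ∀ A → A ∈ Filter 𝒜 → ∃[ B ] (B ∈ ℐ × Robust 𝒥 f A B)
  robust-exists {ℐ = ℐ} {𝒥} {𝒜} 𝒥-ideal tall ≰ fip {f} f∈ℱ shrink A A∈Filter
    with em {P = Finite (PositiveFibres 𝒥 f A)}
  ... | no N-infinite = B , B∈ℐ , robust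
    where
    infinite-part = tall (PositiveFibres 𝒥 f A) N-infinite
    B     = proj₁ infinite-part
    B-inf = proj₁ (proj₂ infinite-part)
    B⊆N   = proj₁ (proj₂ (proj₂ infinite-part))
    B∈ℐ   = proj₂ (proj₂ (proj₂ infinite-part))

    -- An infinite B has an element outside K, and its fibre alone is
    -- positive on A.
    robust : Robust 𝒥 f A B
    robust K small = B-inf (K , λ {n} n∈B → by-contradiction λ n∉K →
      toWitness (B⊆N n∈B)
        (IsIdeal.⊆-closed 𝒥-ideal (λ { (refl , a) → (n∈B , n∉K) , a }) small))
  ... | yes (K , N⊆K) = B , B∈ℐ , robust
    where
    open IsIdeal 𝒥-ideal
    -- On A ∩ A′ all fibres of f are null: those over K because of A′, the
    -- others already on A.
    A′ : Subset ℕ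
    A′ = proj₁ (shrink K)

    null : ∀ n → ((f ⊢ (_≡ n)) ∩ (A ∩ A′)) ∈ 𝒥
    null n with em {P = n ∈ˡ K}
    ... | yes n∈K = ⊆-closed (λ { (refl , _ , a′) → n∈K , a′ })
                             (proj₂ (proj₂ (shrink K)))
    ... | no  n∉K = ⊆-closed (λ (p , a , _) → p , a)
                             (by-contradiction (n∉K ∘ N⊆K ∘ fromWitness))

    hit = positive-preimage ≰ f∈ℱ (A ∩ A′)
            (Filter-⁺ 𝒥-ideal fip
              (Filter-∩ A∈Filter (proj₁ (proj₂ (shrink K)))))
    B   = proj₁ hit
    B∈ℐ = proj₁ (proj₂ hit)

    cover : ∀ L → ((f ⊢ B) ∩ (A ∩ A′)) ⊆
                  (((f ⊢ (B ∖ (_∈ˡ L))) ∩ A) ∪ ((f ⊢ (_∈ˡ L)) ∩ (A ∩ A′)))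
    cover L {x} (b , a) with em {P = f x ∈ˡ L}
    ... | yes ∈L = inj₂ (∈L , a)
    ... | no  ∉L = inj₁ ((b , ∉L) , proj₁ a)

    robust : Robust 𝒥 f A B
    robust L small = proj₂ (proj₂ hit)
      (⊆-closed (cover L) (∪-closed small (null-fibres 𝒥-ideal null L)))

-- Countable and finite setoids

  -- Finitely many elements up to the setoid equality.
  Listable : Cardinal → Set₁
  Listable S = ∃[ xs ] (∀ x → SetoidMembership._∈_ S x xs)

  -- The intersection of all members is the pseudointersection.
  listable⇒pseudointersection : ∀ {𝒥 𝒜 : Family ℕ} → IsIdeal 𝒥 → FIP⁺ 𝒥 𝒜 →
    Listable (card 𝒜) → ∃ (IsPseudointersection⁺ 𝒥 𝒜)
  listable⇒pseudointersection {𝒥} {𝒜} 𝒥-ideal fip (xs , complete) =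
    ⋂ᶠ (sets xs) , proj₂ fip _ (sets⊆𝒜 xs) , λ A A∈𝒜 →
      IsIdeal.finite 𝒥-ideal
        ([] , λ (p , ∉A) →
           ⊥-elim (∉A (below xs (A , A∈𝒜) (complete (A , A∈𝒜)) p)))
    where
    open SetoidMembership (card 𝒜) using () renaming (_∈_ to _∈ₛ_)

    sets : List (∃ 𝒜) → List (Subset ℕ)
    sets = map proj₁

    sets⊆𝒜 : ∀ xs → All (_∈ 𝒜) (sets xs)
    sets⊆𝒜 []               = []
    sets⊆𝒜 ((_ , A∈𝒜) ∷ xs) = A∈𝒜 ∷ sets⊆𝒜 xs

    below : ∀ xs x → x ∈ₛ xs → ⋂ᶠ (sets xs) ⊆ proj₁ x
    below (_ ∷ _)  _ (here x≐y)   (p , _) = proj₂ x≐y p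
    below (_ ∷ xs) x (there x∈xs) (_ , p) = below xs x x∈xs p

  -- The natural numbers, lifted to the universe of cardinals.
  ℵ₀ : Cardinal
  ℵ₀ = On.setoid {B = Lift (lsuc 0ℓ) ℕ} (setoid ℕ) lower

  ℵ₀-least-infinite : ∀ S → ¬ Listable S → ℵ₀ ≤ᶜ S
  ℵ₀-least-infinite S ¬listable = record
    { to        = g ∘ lower
    ; cong      = λ p → Setoid.reflexive S (cong g p)
    ; injective = λ {m} {n} → g-injective (lower m) (lower n)
    }
    where
    open Setoid S using (Carrier; _≈_)
      renaming (refl to ≈-refl; sym to ≈-sym; trans to ≈-trans)
    open SetoidMembership S using () renaming (_∈_ to _∈ₛ_)

    fresh : ∀ xs → ∃[ x ] ¬ (x ∈ₛ xs)
    fresh xs = by-contradiction λ none →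
      ¬listable (xs , λ x → by-contradiction λ x∉xs → none (x , x∉xs))

    -- earlier n lists g 0, …, g (n - 1), which g n avoids.
    earlier : ℕ → List Carrier
    earlier zero    = []
    earlier (suc n) = proj₁ (fresh (earlier n)) ∷ earlier n

    g : ℕ → Carrier
    g n = proj₁ (fresh (earlier n))

    g∈earlier : ∀ {m} n → m < n → g m ∈ₛ earlier n
    g∈earlier (suc n) m<1+n with m<1+n⇒m<n∨m≡n m<1+n
    ... | inj₁ m<n  = there (g∈earlier n m<n)
    ... | inj₂ refl = here ≈-refl

    distinct : ∀ {m n} → m < n → ¬ (g m ≈ g n)
    distinct {n = n} m<n eq = proj₂ (fresh (earlier n))
      (Any.map (≈-trans (≈-sym eq)) (g∈earlier n m<n))

    g-injective : ∀ m n → g m ≈ g n → m ≡ n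
    g-injective m n eq with <-cmp m n
    ... | tri< m<n _ _ = contradiction eq (distinct m<n)
    ... | tri≈ _ m≡n _ = m≡n
    ... | tri> _ _ n<m = contradiction (≈-sym eq) (distinct n<m)

-- Canonical representatives and comparison of cardinals

  module Choice (ext : ∀ {a b} → Extensionality a b) where

    module Representatives {c ℓ} (S : Setoid c ℓ) where
      open Setoid S using (Carrier; _≈_)
        renaming (refl to ≈-refl; sym to ≈-sym; trans to ≈-trans)

      -- An element chosen from a Boolean predicate b. It depends on b alone,
      -- not on the evidence that b is satisfiable (choose-cong).
      choose : (b : Carrier → Bool) → ∃ (T ∘ b) → Carrier
      choose b w with em {P = ∃ (T ∘ b)}
      ... | yes (x , _) = x
      ... | no  empty   = contradiction w empty

      choose-correct : ∀ b w → T (b (choose b w))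
      choose-correct b w with em {P = ∃ (T ∘ b)}
      ... | yes (_ , p) = p
      ... | no  empty   = contradiction w empty

      choose-cong : ∀ {b b′} w w′ → b ≡ b′ → choose b w ≡ choose b′ w′
      choose-cong {b} w w′ refl with em {P = ∃ (T ∘ b)}
      ... | yes _    = refl
      ... | no empty = contradiction w empty

      -- Equivalence classes are Boolean-valued, so that the classes of
      -- equivalent elements are equal by function extensionality alone.
      class : Carrier → Carrier → Bool
      class x y = isYes (em {P = x ≈ y})

      class-cong : ∀ {x y} → x ≈ y → class x ≡ class y
      class-cong {x} {y} x≈y = ext λ z → agree z
        where
        agree : ∀ z → class x z ≡ class y z
        agree z with em {P = x ≈ z} | em {P = y ≈ z}
        ... | yes _   | yes _   = refl
        ... | no  _   | no  _   = refl
        ... | yes x≈z | no  y≉z = contradiction (≈-trans (≈-sym x≈y) x≈z) y≉z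
        ... | no  x≉z | yes y≈z = contradiction (≈-trans x≈y y≈z) x≉z

      inhabited : ∀ x → ∃ (T ∘ class x)
      inhabited x = x , fromWitness ≈-refl

      -- The canonical representative of a class.
      rep : Carrier → Carrier
      rep x = choose (class x) (inhabited x)

      rep-≈ : ∀ x → x ≈ rep x
      rep-≈ x = toWitness (choose-correct (class x) (inhabited x))

      rep-cong : ∀ {x y} → x ≈ y → rep x ≡ rep y
      rep-cong x≈y = choose-cong _ _ (class-cong x≈y)

    -- A right inverse need not respect equality, so it is composed with rep.
    surjection⇒≤ᶜ : ∀ {κ μ : Cardinal} → Surjection κ μ → μ ≤ᶜ κ
    surjection⇒≤ᶜ {κ} {μ} s = record
      { to        = to⁻ ∘ rep
      ; cong      = λ y≈y′ → Setoid.reflexive κ (cong to⁻ (rep-cong y≈y′))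
      ; injective = λ {y} {y′} p →
          trans-μ (rep-≈ y)
            (trans-μ (sym-μ (to∘to⁻ (rep y)))
              (trans-μ (S.cong p)
                (trans-μ (to∘to⁻ (rep y′)) (sym-μ (rep-≈ y′)))))
      }
      where
      module S = Surjection s
      open Representatives μ
      open Setoid μ using () renaming (trans to trans-μ; sym to sym-μ)
      to⁻ = λ y → proj₁ (S.surjective y)
      to∘to⁻ = λ y → proj₂ (S.surjective y) (Setoid.refl κ)

-- Meeting fewer than add* requirements simultaneously

    module _ {ℐ : Family ℕ} {add* : Cardinal} (is-add* : Is-add* ℐ add*) where

      -- A requirement P x on B for each x in a set S with add* ≰ S: the
      -- individual solutions form a family of size at most S, hence are
      -- almost included in a single member of ℐ.
      uniformise :
        ∀ {p} (S : Cardinal) → let open Setoid S using (Carrier; _≈_) in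
        ¬ (add* ≤ᶜ S) → (P : Carrier → Subset ℕ → Set p) →
        (∀ {x y B} → x ≈ y → P x B → P y B) →
        (∀ {x B C} → Finite (B ∖ C) → P x B → P x C) →
        (∀ x → ∃[ B ] (B ∈ ℐ × P x B)) →
        ∃[ C ] (C ∈ ℐ × (∀ x → P x C))
      uniformise S add*≰S P P-resp P-up each =
        let C , C∈ℐ , bound = almost-bound
        in C , C∈ℐ , λ x → P-resp (Setoid.sym S (rep-≈ x))
             (P-up (bound _ (x , refl)) (proj₂ (proj₂ (each (rep x)))))
        where
        open Representatives S

        D : Setoid.Carrier S → Subset ℕ
        D x = proj₁ (each (rep x))

        𝒟 : Family ℕ
        𝒟 E = ∃[ x ] (E ≡ D x)

        𝒟⊆ℐ : 𝒟 ⊆ ℐ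
        𝒟⊆ℐ (x , refl) = proj₁ (proj₂ (each (rep x)))

        D-cong : ∀ {x y} → Setoid._≈_ S x y → D x ≐ D y
        D-cong x≈y = Setoid.reflexive (≐-setoid ℕ 0ℓ)
                       (cong (λ z → proj₁ (each z)) (rep-cong x≈y))

        D-onto : Surjection S (card 𝒟)
        D-onto = record
          { to         = λ x → D x , x , refl
          ; cong       = D-cong
          ; surjective = λ { (_ , x , refl) → x , D-cong }
          }

        almost-bound : ∃[ C ] (C ∈ ℐ × (∀ A → A ∈ 𝒟 → Finite (A ∖ C)))
        almost-bound = by-contradiction λ unbounded → add*≰S
          (Injectionₚ.trans
            (IsMinimum.least is-add* (card 𝒟)
              (𝒟 , (𝒟⊆ℐ , unbounded) , Identity.bijection _))
            (surjection⇒≤ᶜ D-onto))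

      -- One B serves the intersections of A with any n members of 𝒜.
      uniform-length :
        ∀ {𝒥 𝒜 : Family ℕ} {f} → IsIdeal 𝒥 → ¬ (add* ≤ᶜ card 𝒜) →
        (∀ A → A ∈ Filter 𝒜 → ∃[ B ] (B ∈ ℐ × Robust 𝒥 f A B)) →
        ∀ n A → A ∈ Filter 𝒜 → ∃[ B ] (B ∈ ℐ × RobustBelow 𝒥 f 𝒜 n A B)
      uniform-length 𝒥-ideal add*≰ base zero = base
      uniform-length {𝒥} {𝒜} {f} 𝒥-ideal add*≰ base (suc n) A A∈Filter =
        let B , B∈ℐ , r = uniformise (card 𝒜) add*≰
              (λ (A′ , _) → RobustBelow 𝒥 f 𝒜 n (A ∩ A′))
              (λ x≐y → RobustBelow-mono 𝒥-ideal n (λ (a , p) → a , proj₁ x≐y p))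
              (RobustBelow-almost-mono 𝒥-ideal n)
              (λ (A′ , A′∈𝒜) → uniform-length 𝒥-ideal add*≰ base n (A ∩ A′)
                                 (Filter-∩ A∈Filter (⊆Filter A′∈𝒜)))
        in B , B∈ℐ , λ A′ A′∈𝒜 → r (A′ , A′∈𝒜)

      -- A family 𝒜 with add* ≰ |𝒜| is not one of those that define 𝔣𝔦𝔭.
      small-extends :
        ∀ {ℱ} {𝒥 𝒜 : Family ℕ} → IsIdeal ℐ → IsIdeal 𝒥 → Tall ℐ →
        (∀ A → A ∉ 𝒥 → ¬ (ℐ ≤[ ℱ ] 𝒥 ↾ A)) →
        FIP⁺ 𝒥 𝒜 → ¬ (add* ≤ᶜ card 𝒜) →
        ∀ f → f ∈ ℱ → ∃[ B ] (B ∈ ℐ × FIP⁺ 𝒥 (𝒜 ▹ (f ⊢ B)))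
      small-extends {𝒥 = 𝒥} {𝒜} ℐ-ideal 𝒥-ideal tall ≰ fip add*≰ f f∈ℱ
        with em {P = Listable (card 𝒜)}
           | em {P = ∃[ K ] (∀ A → A ∈ Filter 𝒜 → ((f ⊢ (_∈ˡ K)) ∩ A) ∉ 𝒥)}
      ... | yes listable | _ =
        pseudointersection⇒extends 𝒥-ideal ≰ (proj₁ fip)
          (listable⇒pseudointersection 𝒥-ideal fip listable) f f∈ℱ
      ... | no _ | yes (K , pos) =
        (_∈ˡ K) , IsIdeal.finite ℐ-ideal (K , id) ,
        extend-FIP 𝒥-ideal (proj₁ fip) λ F F⊆𝒜 → pos (⋂ᶠ F) (F , F⊆𝒜 , id)
      ... | no infinite | no none =
        let B , B∈ℐ , r = uniformise ℵ₀
              (λ add*≤ℵ₀ → add*≰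
                 (Injectionₚ.trans add*≤ℵ₀
                   (ℵ₀-least-infinite (card 𝒜) infinite)))
              (λ n → RobustBelow 𝒥 f 𝒜 (lower n) U)
              (λ { refl → id })
              (λ {n} → RobustBelow-almost-mono 𝒥-ideal (lower n))
              (λ n → uniform-length 𝒥-ideal add*≰
                       (robust-exists 𝒥-ideal tall ≰ fip f∈ℱ shrink)
                       (lower n) U U∈Filter)
        in B , B∈ℐ , extend-FIP 𝒥-ideal (proj₁ fip) λ F F⊆𝒜 →
             ⁺-mono 𝒥-ideal (λ ((b , _) , _ , p) → b , p)
               (RobustBelow⇒⋂ 𝒥-ideal F F⊆𝒜 (r (lift (length F))) [])
        where
        shrink : ∀ K → ∃[ A ] (A ∈ Filter 𝒜 × ((f ⊢ (_∈ˡ K)) ∩ A) ∈ 𝒥)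
        shrink K = by-contradiction λ no-A →
          none (K , λ A A∈Filter small → no-A (A , A∈Filter , small))

-- Comparison of the cardinal invariants

theorem4p1 : (∀ {ℓ} → ExcludedMiddle ℓ) → (∀ {a b} → Extensionality a b) →
    (ℱ : Functions) (ℐ 𝒥 : Family ℕ) →
    IsIdeal ℐ → IsIdeal 𝒥 → Tall ℐ →
    (∀ A → A ∉ 𝒥 → ¬ (ℐ ≤[ ℱ ] 𝒥 ↾ A)) →
    (∀ 𝔭 𝔣𝔦𝔭 → Is-𝔭 𝒥 𝔭 → Is-𝔣𝔦𝔭 ℐ 𝒥 ℱ 𝔣𝔦𝔭 → 𝔭 ≤ᶜ 𝔣𝔦𝔭) ×
    (∀ add* 𝔣𝔦𝔭 → Is-add* ℐ add* → Is-𝔣𝔦𝔭 ℐ 𝒥 ℱ 𝔣𝔦𝔭 → add* ≤ᶜ 𝔣𝔦𝔭)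
theorem4p1 em ext ℱ ℐ 𝒥 ℐ-ideal 𝒥-ideal tall ≰ = part₁ , part₂
  where
  open Classical em
  open Choice ext

  part₁ : ∀ 𝔭 𝔣𝔦𝔭 → Is-𝔭 𝒥 𝔭 → Is-𝔣𝔦𝔭 ℐ 𝒥 ℱ 𝔣𝔦𝔭 → 𝔭 ≤ᶜ 𝔣𝔦𝔭
  part₁ 𝔭 𝔣𝔦𝔭 is-𝔭 is-𝔣𝔦𝔭 with IsMinimum.member is-𝔣𝔦𝔭
  ... | inj₂ successor = IsMinimum.least is-𝔭 𝔣𝔦𝔭 (inj₂ successor)
  ... | inj₁ (𝒜 , (fip , bad) , 𝔣𝔦𝔭≈𝒜) = IsMinimum.least is-𝔭 𝔣𝔦𝔭
    (inj₁ ( 𝒜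
          , (fip , bad ∘ pseudointersection⇒extends 𝒥-ideal ≰ (proj₁ fip))
          , 𝔣𝔦𝔭≈𝒜))

  part₂ : ∀ add* 𝔣𝔦𝔭 → Is-add* ℐ add* → Is-𝔣𝔦𝔭 ℐ 𝒥 ℱ 𝔣𝔦𝔭 → add* ≤ᶜ 𝔣𝔦𝔭
  part₂ add* 𝔣𝔦𝔭 is-add* is-𝔣𝔦𝔭
    with IsMinimum.member is-𝔣𝔦𝔭 | IsMinimum.member is-add*
  -- add* is the size of a family of subsets of ℕ, so add* ≤ 𝔠 < 𝔠⁺.
  ... | inj₂ ((𝔠≤𝔣𝔦𝔭 , _) , _) | 𝒟 , _ , add*≈𝒟 =
    Injectionₚ.trans (Bijection.injection add*≈𝒟)
      (Injectionₚ.trans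
        (record { to = proj₁ ; cong = id ; injective = id }) 𝔠≤𝔣𝔦𝔭)
  ... | inj₁ (𝒜 , (fip , bad) , 𝔣𝔦𝔭≈𝒜) | _ =
    Injectionₚ.trans
      (by-contradiction λ add*≰𝒜 →
         bad (small-extends is-add* ℐ-ideal 𝒥-ideal tall ≰ fip add*≰𝒜))
      (surjection⇒≤ᶜ (Bijection.surjection 𝔣𝔦𝔭≈𝒜))
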